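{- Let $\varphi \in \mathbb{Z}[z]$ be the polynomial $\varphi(z) = z^d + c$, where $c, d \in \mathbb{Z}$ and $d \geq 2$. Suppose that zero is a wandering point of $\varphi$, and write $b_n = \varphi^n(0)$ for $n \geq 1$. Then: (1) If $c = \pm 1$, then $b_n$ contains a primitive prime divisor for all $n \geq 2$. (2) For all other $c \in \mathbb{Z}$, $b_n$ contains a primitive prime divisor for all $n \geq 1$.
   Context: Here $\varphi^n = \varphi \circ \varphi \circ \dots \circ \varphi$ ($n$ times) denotes the $n$-th iterate of $\varphi$. The orbit of $\alpha \in \mathbb{Z}$ under $\varphi$ is the set $\{\varphi(\alpha), \varphi^2(\alpha), \dots\}$; $\alpha$ is called a wandering point of $\varphi$ if this orbit is infinite. Given a sequence of integers $(b_n) = (b_1, b_2, \dots)$, the term $b_n$ contains a primitive prime divisor (also called a primitive prime) if there exists a prime $p$ such that $p \mid b_n$ but $p \nmid b_i$ for all $1 \le i < n$. -}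

module Defs where

open import Data.Integer using (ℤ; +_; _+_; _^_)
open import Data.Integer.Divisibility using (_∣_)
open import Data.List.Membership.Propositional using (_∈_)
open import Data.Nat as ℕ using (ℕ)
open import Data.Nat.Primality using (Prime)
open import Data.Product using (∃-syntax; _×_)
open import Function.Bundles using (_⇔_)
open import Function.Endo.Propositional ℤ using (Endo) renaming (_^_ to iter)
open import Level using (0ℓ)
open import Relation.Binary.PropositionalEquality using (_≡_)
open import Relation.Nullary using (¬_)
open import Relation.Unary using (Pred)

Finite : Pred ℤ 0ℓ → Set
Finite P = ∃[ xs ] (∀ x → P x ⇔ x ∈ xs)

Infinite : Pred ℤ 0ℓ → Set
Infinite P = ¬ Finite P

infixl 9 _⟨_⟩

_⟨_⟩ : Endo → ℕ → Endo
φ ⟨ n ⟩ = iter φ n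

-- The orbit starts at φ α, so α itself need not belong to it.
Orbit : Endo → ℤ → Pred ℤ 0ℓ
Orbit φ α x = ∃[ n ] (1 ℕ.≤ n × x ≡ (φ ⟨ n ⟩) α)

Wandering : Endo → ℤ → Set
Wandering φ α = Infinite (Orbit φ α)

-- Sequences are indexed from 1: the value b 0 is never consulted when n ≥ 1.
HasPrimitivePrimeDivisor : (ℕ → ℤ) → ℕ → Set
HasPrimitivePrimeDivisor b n =
  ∃[ p ] (Prime p × + p ∣ b n × (∀ i → 1 ℕ.≤ i → i ℕ.< n → ¬ (+ p ∣ b i)))

-- The polynomial z ^ d + c, as the map ℤ → ℤ it induces.
unicritical : ℕ → ℤ → Endo
unicritical d c z = z ^ d + c

{-# OPTIONS --safe #-}
-- Write a n = |b n|.  Congruences are preserved by φ, and φ z ≡ φ 0 modulo z², so that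
-- b (k + i) ≡ b i modulo (b k)² for all i ≥ 1.  Two consequences: a common divisor of b k
-- and b n divides b (n mod k), and b (m k) = b k · u with u prime to b k.  Removing from
-- a n, for k = 1, …, n - 1 in turn, its common factor with a k therefore costs at most a
-- factor a k and leaves a divisor of a n that is prime to all earlier terms.  This divisor
-- exceeds 1, hence has a prime factor, as soon as a n > a 1 ⋯ a (n - 1).  That inequality
-- follows by induction from (a n)² ≤ a (n + 1) + a 1, once a 2 > a 1; and a 2 ≤ a 1 forces
-- the orbit of zero to be finite.
module Submission where

open import Defs
open import Data.Integer using (ℤ; 0ℤ; 1ℤ; -1ℤ; +_; -[1+_]; ∣_∣; _+_; _-_; _*_; _^_)
open import Data.Integer.Divisibility.Signed as ℤD using (divides)
import Data.Integer.Properties as ℤP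
open import Data.Integer.Solver using (module +-*-Solver)
open import Data.List using ([]; _∷_)
open import Data.List.Membership.Propositional using (_∈_)
open import Data.List.Relation.Unary.All using (All; _∷_)
open import Data.List.Relation.Unary.Any using (here; there)
open import Data.Nat as ℕ using (ℕ; zero; suc; _≤_; _<_; z≤n; s≤s)
open import Data.Nat.Coprimality as Coprimality using (Coprime; coprime-divisor)
open import Data.Nat.Divisibility as ℕD using (_∣_; _∣?_)
open import Data.Nat.DivMod using (_%_; _/_; m≡m%n+[m/n]*n; m%n<n; m/n*n≡m)
open import Data.Nat.GCD using (gcd; gcd[m,n]∣m; gcd[m,n]∣n; gcd[m,n]≢0; gcd[m,n]≤n)
open import Data.Nat.ListAction using (product)
open import Data.Nat.Primality using (Prime; ¬prime[1])
open import Data.Nat.Primality.Factorisation using (factorise; module PrimeFactorisation)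
import Data.Nat.Properties as ℕP
open import Data.Product using (_×_; _,_; ∃-syntax; proj₁; proj₂)
open import Data.Sum using (_⊎_; inj₁; inj₂; [_,_]′)
open import Function.Base using (_∘_)
open import Function.Bundles using (mk⇔)
open import Relation.Binary.PropositionalEquality using (_≡_; refl; sym; trans; cong; subst)
open import Relation.Nullary using (¬_; yes; no; contradiction)

-- Prime divisors and coprime parts

∃-prime-divisor : ∀ {n} → 1 < n → ∃[ p ] (Prime p × p ∣ n)
∃-prime-divisor {n} 1<n = go (factors , isFactorisation , factorsPrime)
  where
  instance
    _ : ℕ.NonZero n
    _ = ℕ.>-nonZero (ℕP.<-trans (s≤s z≤n) 1<n)
  open PrimeFactorisation (factorise n)
  go : ∃[ ps ] (n ≡ product ps × All Prime ps) → ∃[ p ] (Prime p × p ∣ n)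
  go ([]     , refl , _)      = contradiction 1<n (ℕP.<-irrefl refl)
  go (p ∷ ps , eq   , pr ∷ _) = p , pr , subst (p ∣_) (sym eq) (ℕD.m∣m*n (product ps))

-- Take `z = x / gcd x y`. In general it may still share a factor with `y`, but here `z` divides
-- `y′ u` and is prime to `y′`, so it divides `u`, which is prime to `y`.
coprime-part : ∀ x y u .{{_ : ℕ.NonZero y}} → x ∣ y ℕ.* u → Coprime u y →
               ∃[ z ] (z ∣ x × x ≤ z ℕ.* y × Coprime z y)
coprime-part x y u x∣yu u⊥y = z , ℕD.divides g (trans x≡zg (ℕP.*-comm z g)) , x≤zy , z⊥y
  where
  g = gcd x y
  instance
    g≢0 : ℕ.NonZero g
    g≢0 = ℕ.≢-nonZero (gcd[m,n]≢0 x y (inj₂ (ℕ.≢-nonZero⁻¹ y)))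
  z = x / g
  y′ = y / g
  x≡zg : x ≡ z ℕ.* g
  x≡zg = sym (m/n*n≡m (gcd[m,n]∣m x y))
  y≡gy′ : y ≡ g ℕ.* y′
  y≡gy′ = trans (sym (m/n*n≡m (gcd[m,n]∣n x y))) (ℕP.*-comm y′ g)
  x≤zy : x ≤ z ℕ.* y
  x≤zy = subst (_≤ z ℕ.* y) (sym x≡zg) (ℕP.*-monoʳ-≤ z (gcd[m,n]≤n x y))
  gz∣g[y′u] : g ℕ.* z ∣ g ℕ.* (y′ ℕ.* u)
  gz∣g[y′u] = subst (g ℕ.* z ∣_) (ℕP.*-assoc g y′ u)
    (subst (λ w → g ℕ.* z ∣ w ℕ.* u) y≡gy′
      (subst (_∣ y ℕ.* u) (trans x≡zg (ℕP.*-comm z g)) x∣yu))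
  z∣u : z ∣ u
  z∣u = coprime-divisor (Coprimality.coprime-/gcd x y) (ℕD.*-cancelˡ-∣ g gz∣g[y′u])
  z⊥y : Coprime z y
  z⊥y (e∣z , e∣y) = u⊥y (ℕD.∣-trans e∣z z∣u , e∣y)

-- Sieving out the earlier terms

-- The factors are indexed from 1, so a 0 is not among them.
∏≤ : (ℕ → ℕ) → ℕ → ℕ
∏≤ a zero    = 1
∏≤ a (suc k) = a (suc k) ℕ.* ∏≤ a k

-- By `multiple`, a prime dividing `a k` with `k ≥ 1` occurs to the same power in every `a (m k)`
-- with `m ≥ 1`; `remainder` reduces an index `n` to `n mod k`.
record RigidDivisibility (a : ℕ → ℕ) : Set where
  field
    positive  : ∀ k → 0 < a (suc k)
    remainder : ∀ {e} k q r → e ∣ a k → e ∣ a (r ℕ.+ q ℕ.* k) → e ∣ a r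
    multiple  : ∀ k q → ∃[ u ] (a (suc q ℕ.* k) ≡ a k ℕ.* u × Coprime u (a k))

module _ {a : ℕ → ℕ} (rigid : RigidDivisibility a) where
  open RigidDivisibility rigid

  sieve : ∀ n k → k < n →
          ∃[ x ] (x ∣ a n × a n ≤ x ℕ.* ∏≤ a k × (∀ i → 1 ≤ i → i ≤ k → Coprime x (a i)))
  sieve n zero 0<n =
    a n , ℕD.∣-refl , ℕP.≤-reflexive (sym (ℕP.*-identityʳ (a n))) ,
    λ i 1≤i i≤0 → contradiction (ℕP.≤-trans 1≤i i≤0) λ ()
  sieve n (suc k) k+1<n with sieve n k (ℕP.<-trans (ℕP.n<1+n k) k+1<n)
  ... | x , x∣an , an≤ , x⊥ = z , ℕD.∣-trans z∣x x∣an , an≤′ , z⊥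
    where
    K = suc k
    instance
      aK≢0 : ℕ.NonZero (a K)
      aK≢0 = ℕ.>-nonZero (positive k)
    refine : ∃[ z ] (z ∣ x × x ≤ z ℕ.* a K × Coprime z (a K))
    refine with K ∣? n
    ... | yes (ℕD.divides zero refl) = contradiction k+1<n λ ()
    ... | yes (ℕD.divides (suc q) refl) =
      let u , eq , u⊥ = multiple K q in coprime-part x (a K) u (subst (x ∣_) eq x∣an) u⊥
    -- Nothing has to be removed: a common divisor of `x` and `a K` divides `a (n % K)`, and `x` is
    -- already prime to that term because `1 ≤ n % K < K`.
    ... | no K∤n = x , ℕD.∣-refl , ℕP.m≤m*n x (a K) , λ {e} (e∣x , e∣aK) →
      x⊥ (n % K) (ℕP.n≢0⇒n>0 (K∤n ∘ ℕD.m%n≡0⇒n∣m n K)) (ℕP.≤-pred (m%n<n n K))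
        (e∣x , remainder K (n / K) (n % K) e∣aK
          (subst (λ w → e ∣ a w) (m≡m%n+[m/n]*n n K) (ℕD.∣-trans e∣x x∣an)))
    z = proj₁ refine
    z∣x = proj₁ (proj₂ refine)
    x≤ = proj₁ (proj₂ (proj₂ refine))
    an≤′ : a n ≤ z ℕ.* ∏≤ a K
    an≤′ = begin
      a n                         ≤⟨ an≤ ⟩
      x ℕ.* ∏≤ a k                ≤⟨ ℕP.*-monoˡ-≤ (∏≤ a k) x≤ ⟩
      z ℕ.* a K ℕ.* ∏≤ a k        ≡⟨ ℕP.*-assoc z (a K) (∏≤ a k) ⟩
      z ℕ.* ∏≤ a K                ∎
      where open ℕP.≤-Reasoning
    z⊥ : ∀ i → 1 ≤ i → i ≤ K → Coprime z (a i)
    z⊥ i 1≤i i≤K with ℕP.m≤n⇒m<n∨m≡n i≤K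
    ... | inj₁ i<K  = λ (e∣z , e∣ai) → x⊥ i 1≤i (ℕP.≤-pred i<K) (ℕD.∣-trans e∣z z∣x , e∣ai)
    ... | inj₂ refl = proj₂ (proj₂ (proj₂ refine))

  -- The sieve run up to `n` leaves a divisor `x` with `a (suc n) ≤ x · ∏≤ a n`, so the hypothesis
  -- forces `x > 1`, and any prime factor of `x` is primitive.
  ∃-primitive-prime : ∀ n → ∏≤ a n < a (suc n) →
    ∃[ p ] (Prime p × p ∣ a (suc n) × (∀ i → 1 ≤ i → i < suc n → ¬ p ∣ a i))
  ∃-primitive-prime n ∏<a =
    let x , x∣a , a≤ , x⊥ = sieve (suc n) n (ℕP.n<1+n n)
        1<x = ℕP.*-cancelʳ-< (∏≤ a n) 1 x
                (ℕP.<-≤-trans (subst (_< a (suc n)) (sym (ℕP.*-identityˡ _)) ∏<a) a≤)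
        p , p-prime , p∣x = ∃-prime-divisor 1<x
    in p , p-prime , ℕD.∣-trans p∣x x∣a , λ i 1≤i i<n p∣ai →
      ¬prime[1] (subst Prime (x⊥ i 1≤i (ℕP.≤-pred i<n) (p∣x , p∣ai)) p-prime)

-- Growth beyond the product of earlier terms

module _ (a : ℕ → ℕ) (a₁>0 : 0 < a 1) (a₁<a₂ : a 1 < a 2)
         (square-growth : ∀ n → a n ℕ.* a n ≤ a (suc n) ℕ.+ a 1) where

  -- In the inductive step let `A = suc B` be the term at index `n + 2`. Then
  -- `next ≥ A² - a 1 > A² - A = A B`, while the new product is at most `A B`. The bound on `a 1` is
  -- carried along because the strict inequality rests on it.
  growth : ∀ n → a 1 < a (suc (suc n)) × ∏≤ a (suc n) < a (suc (suc n))
  growth zero = a₁<a₂ , subst (_< a 2) (sym (ℕP.*-identityʳ (a 1))) a₁<a₂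
  growth (suc n) with a (suc (suc n)) | square-growth (suc (suc n)) | growth n
  ... | suc B | sq | s≤s a₁≤B , s≤s ∏≤B =
    ℕP.≤-<-trans (ℕP.≤-trans a₁≤B (ℕP.m≤n*m B (suc B))) A*B<next ,
    ℕP.≤-<-trans (ℕP.*-monoʳ-≤ (suc B) ∏≤B) A*B<next
    where
    next = a (suc (suc (suc n)))
    A*B<next : suc B ℕ.* B < next
    A*B<next = ℕP.+-cancelʳ-< (suc B) (suc B ℕ.* B) next (begin-strict
      suc B ℕ.* B ℕ.+ suc B   ≡⟨ ℕP.+-comm (suc B ℕ.* B) (suc B) ⟩
      suc B ℕ.+ suc B ℕ.* B   ≡⟨ ℕP.*-suc (suc B) B ⟨
      suc B ℕ.* suc B         ≤⟨ sq ⟩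
      next ℕ.+ a 1            <⟨ ℕP.+-monoʳ-< next (s≤s a₁≤B) ⟩
      next ℕ.+ suc B          ∎)
      where open ℕP.≤-Reasoning

-- Powers of integers

abs-^ : ∀ i n → ∣ i ^ n ∣ ≡ ∣ i ∣ ℕ.^ n
abs-^ i zero    = refl
abs-^ i (suc n) = trans (ℤP.abs-* i (i ^ n)) (cong (∣ i ∣ ℕ.*_) (abs-^ i n))

-- Congruence of x and y modulo m is expressed as divisibility of x - y by m.
^-cong-mod : ∀ {m} x y n → m ℤD.∣ x - y → m ℤD.∣ x ^ n - y ^ n
^-cong-mod x y zero _ = divides 0ℤ refl
^-cong-mod {m} x y (suc n) m∣x-y =
  subst (m ℤD.∣_) (identity x y (x ^ n) (y ^ n))
    (ℤD.∣m∣n⇒∣m+n (ℤD.∣n⇒∣m*n x (^-cong-mod x y n m∣x-y)) (ℤD.∣m⇒∣m*n (y ^ n) m∣x-y))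
  where
  open +-*-Solver
  identity : ∀ x y p q → x * (p - q) + (x - y) * q ≡ x * p - y * q
  identity = solve 4 (λ x y p q → x :* (p :- q) :+ (x :- y) :* q := x :* p :- y :* q) refl

-- As `i` divides 2, only `∣ i ∣ ≤ 2` is possible; absolute value 1 gives powers of absolute value
-- 1, and 2 forces `n = 0`. This isolates the exceptional map `z² - 2`.
i*i^n≡-2⇒ : ∀ i n → i * i ^ n ≡ -[1+ 1 ] → n ≡ 0 × i ≡ -[1+ 1 ]
i*i^n≡-2⇒ i n eq = go i ∣i∣≤2 eq abs-eq
  where
  abs-eq : ∣ i ∣ ℕ.* ∣ i ∣ ℕ.^ n ≡ 2
  abs-eq = trans (sym (abs-^ i (suc n))) (cong ∣_∣ eq)
  ∣i∣≤2 : ∣ i ∣ ≤ 2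
  ∣i∣≤2 = ℕD.∣⇒≤ (subst (∣ i ∣ ∣_) abs-eq (ℕD.m∣m*n (∣ i ∣ ℕ.^ n)))
  one : ¬ 1 ℕ.* 1 ℕ.^ n ≡ 2
  one eq rewrite ℕP.^-zeroˡ n = contradiction eq λ ()
  two : 2 ℕ.* 2 ℕ.^ n ≡ 2 → n ≡ 0
  two eq with ℕP.m^n≡1⇒n≡0∨m≡1 2 n (ℕP.*-cancelˡ-≡ _ 1 2 eq)
  ... | inj₁ n≡0 = n≡0
  go : ∀ i → ∣ i ∣ ≤ 2 → i * i ^ n ≡ -[1+ 1 ] → ∣ i ∣ ℕ.* ∣ i ∣ ℕ.^ n ≡ 2 →
       n ≡ 0 × i ≡ -[1+ 1 ]
  go (+ 0) _ _ ()
  go (+ 1) _ _ abs = contradiction abs one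
  go (+ 2) _ eq abs with two abs
  ... | refl = contradiction eq λ ()
  go (+ suc (suc (suc _))) (s≤s (s≤s ())) _ _
  go -[1+ 0 ] _ _ abs = contradiction abs one
  go -[1+ 1 ] _ _ abs = two abs , refl
  go -[1+ suc (suc _) ] (s≤s (s≤s ())) _ _

-- Congruences and growth along the orbit of zero

-- The degree is k + 2.
module ZeroOrbit (k : ℕ) (c : ℤ) where

  φ : ℤ → ℤ
  φ = unicritical (suc (suc k)) c

  b : ℕ → ℤ
  b n = (φ ⟨ n ⟩) 0ℤ

  a : ℕ → ℕ
  a n = ∣ b n ∣

  b₁≡c : b 1 ≡ c
  b₁≡c = ℤP.+-identityˡ c

  φ-cong-mod : ∀ {m} x y → m ℤD.∣ x - y → m ℤD.∣ φ x - φ y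
  φ-cong-mod {m} x y m∣ =
    subst (m ℤD.∣_) (identity (x ^ suc (suc k)) (y ^ suc (suc k)) c)
      (^-cong-mod x y (suc (suc k)) m∣)
    where
    open +-*-Solver
    identity : ∀ p q c → p - q ≡ p + c - (q + c)
    identity = solve 3 (λ p q c → p :- q := p :+ c :- (q :+ c)) refl

  -- Zero is a critical point: `φ` has no linear term, which is the source of the square in the
  -- modulus.
  φ-ramified : ∀ z → z * z ℤD.∣ φ z - φ 0ℤ
  φ-ramified z = divides (z ^ k) (identity z (z ^ k) c)
    where
    open +-*-Solver
    identity : ∀ z p c → z * (z * p) + c - (0ℤ + c) ≡ p * (z * z)
    identity = solve 3 (λ z p c → z :* (z :* p) :+ c :- (con 0ℤ :+ c) := p :* (z :* z)) refl

  shift-mod-square : ∀ m i → b m * b m ℤD.∣ b (suc i ℕ.+ m) - b (suc i)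
  shift-mod-square m zero    = φ-ramified (b m)
  shift-mod-square m (suc i) = φ-cong-mod (b (suc i ℕ.+ m)) (b (suc i)) (shift-mod-square m i)

  -- The square is given up to admit `i = 0`, where `b m - b 0` is only `b m` itself.
  shift-mod : ∀ m i → b m ℤD.∣ b (i ℕ.+ m) - b i
  shift-mod m zero    = ℤD.∣-reflexive (sym (ℤP.+-identityʳ (b m)))
  shift-mod m (suc i) = ℤD.∣-trans (ℤD.∣m⇒∣m*n (b m) ℤD.∣-refl) (shift-mod-square m i)

  ∣-remainder : ∀ {e} m q r → e ∣ a m → e ∣ a (r ℕ.+ q ℕ.* m) → e ∣ a r
  ∣-remainder {e} m zero r _ e∣ = subst (λ w → e ∣ a w) (ℕP.+-identityʳ r) e∣
  ∣-remainder {e} m (suc q) r e∣am e∣ = ∣-remainder m q r e∣am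
    (ℤD.∣⇒∣ᵤ {+ e} {b r′} (subst (+ e ℤD.∣_) (identity (b (r′ ℕ.+ m)) (b r′))
      (ℤD.∣m∣n⇒∣m-n (ℤD.∣ᵤ⇒∣ {+ e} {b (r′ ℕ.+ m)} (subst (λ w → e ∣ a w) index e∣))
        (ℤD.∣-trans (ℤD.∣ᵤ⇒∣ {+ e} {b m} e∣am) (shift-mod m r′)))))
    where
    r′ = r ℕ.+ q ℕ.* m
    index : r ℕ.+ suc q ℕ.* m ≡ r′ ℕ.+ m
    index = trans (cong (r ℕ.+_) (ℕP.+-comm m (q ℕ.* m))) (sym (ℕP.+-assoc r (q ℕ.* m) m))
    open +-*-Solver
    identity : ∀ x y → x - (x - y) ≡ y
    identity = solve 2 (λ x y → x :- (x :- y) := y) refl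

  -- Shifts by `M` telescope. The index is `suc m` so that every term compared has positive index,
  -- as the modulus `(b M)²` requires.
  multiple-mod-square : ∀ m q → b (suc m) * b (suc m) ℤD.∣ b (suc q ℕ.* suc m) - b (suc m)
  multiple-mod-square m zero =
    subst (λ w → b (suc m) * b (suc m) ℤD.∣ b w - b (suc m)) (sym (ℕP.*-identityˡ (suc m)))
      (divides 0ℤ (ℤP.+-inverseʳ (b (suc m))))
  multiple-mod-square m (suc q) =
    subst (b M * b M ℤD.∣_)
      (trans (telescope (b (suc q ℕ.* M ℕ.+ M)) (b (suc q ℕ.* M)) (b M))
        (cong (λ w → b w - b M) (ℕP.+-comm (suc q ℕ.* M) M)))
      (ℤD.∣m∣n⇒∣m+n (shift-mod-square M (m ℕ.+ q ℕ.* M)) (multiple-mod-square m q))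
    where
    M = suc m
    open +-*-Solver
    telescope : ∀ x y z → (x - y) + (y - z) ≡ x - z
    telescope = solve 3 (λ x y z → (x :- y) :+ (y :- z) := x :- z) refl

  multiple : ∀ m q → ∃[ u ] (a (suc q ℕ.* m) ≡ a m ℕ.* u × Coprime u (a m))
  -- Both indices are 0 and `a 0 = 0`, so the cofactor 1 serves.
  multiple zero q = 1 , cong a (ℕP.*-zeroʳ q) , Coprimality.1-coprimeTo 0
  multiple m@(suc m-1) q with multiple-mod-square m-1 q
  ... | divides t eq = ∣ u ∣ , trans (cong ∣_∣ b≡) (ℤP.abs-* (b m) u) , coprime
    where
    u = 1ℤ + t * b m
    open +-*-Solver
    add-back : ∀ x y → x ≡ x - y + y
    add-back = solve 2 (λ x y → x := x :- y :+ y) refl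
    factor : ∀ t y → t * (y * y) + y ≡ y * (1ℤ + t * y)
    factor = solve 2 (λ t y → t :* (y :* y) :+ y := y :* (con 1ℤ :+ t :* y)) refl
    b≡ : b (suc q ℕ.* m) ≡ b m * u
    b≡ = trans (add-back _ (b m)) (trans (cong (_+ b m) eq) (factor t (b m)))
    coprime : Coprime ∣ u ∣ (a m)
    coprime {e} (e∣u , e∣b) = ℕD.∣1⇒≡1 (ℤD.∣⇒∣ᵤ {+ e} {1ℤ}
      (ℤD.∣m+n∣n⇒∣m {m = 1ℤ} {t * b m} (ℤD.∣ᵤ⇒∣ {+ e} {u} e∣u)
        (ℤD.∣n⇒∣m*n t (ℤD.∣ᵤ⇒∣ {+ e} {b m} e∣b))))

  -- The triangle inequality for `b n ^ d = b (suc n) - b 1`, where `d ≥ 2`.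
  square-growth : ∀ n → a n ℕ.* a n ≤ a (suc n) ℕ.+ a 1
  square-growth n = begin
    a n ℕ.* a n                 ≤⟨ square≤power (a n) ⟩
    a n ℕ.^ suc (suc k)         ≡⟨ abs-^ (b n) (suc (suc k)) ⟨
    ∣ b n ^ suc (suc k) ∣       ≡⟨ cong ∣_∣ (identity (b n ^ suc (suc k)) c) ⟩
    ∣ b (suc n) - b 1 ∣         ≤⟨ ℤP.∣i-j∣≤∣i∣+∣j∣ (b (suc n)) (b 1) ⟩
    a (suc n) ℕ.+ a 1           ∎
    where
    open ℕP.≤-Reasoning
    open +-*-Solver using (solve; _:+_; _:-_; _:=_; con)
    square≤power : ∀ x → x ℕ.* x ≤ x ℕ.^ suc (suc k)
    square≤power zero      = z≤n
    square≤power x@(suc _) = ℕP.*-monoʳ-≤ x (ℕP.m≤m*n x (x ℕ.^ k) {{ℕP.m^n≢0 x k}})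
    identity : ∀ p c → p ≡ p + c - (0ℤ + c)
    identity = solve 2 (λ p c → p := p :+ c :- (con 0ℤ :+ c)) refl

  -- Finite orbits of zero

  b₃∈⇒¬wandering : b 3 ≡ b 1 ⊎ b 3 ≡ b 2 → ¬ Wandering φ 0ℤ
  b₃∈⇒¬wandering b₃∈ wandering = wandering (xs , λ x → mk⇔ to from)
    where
    xs = b 1 ∷ b 2 ∷ []
    φ-closed : ∀ {x} → x ∈ xs → φ x ∈ xs
    φ-closed (here refl)         = there (here refl)
    φ-closed (there (here refl)) = [ here , (λ eq → there (here eq)) ]′ b₃∈
    b∈xs : ∀ n → b (suc n) ∈ xs
    b∈xs zero    = here refl
    b∈xs (suc n) = φ-closed (b∈xs n)
    to : ∀ {x} → Orbit φ 0ℤ x → x ∈ xs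
    to (suc n , _ , refl) = b∈xs n
    from : ∀ {x} → x ∈ xs → Orbit φ 0ℤ x
    from (here refl)         = 1 , s≤s z≤n , refl
    from (there (here refl)) = 2 , s≤s z≤n , refl

  c≡0⇒b₃≡b₁ : c ≡ 0ℤ → b 3 ≡ b 1
  c≡0⇒b₃≡b₁ refl = refl

  -- Since `b 2 = c (e + 1)` with `e = c ^ (k + 1)`, for nonzero `c` the factor `e + 1` is 0, 1 or
  -- -1.
  a₂≤a₁⇒b₃∈ : a 2 ≤ a 1 → b 3 ≡ b 1 ⊎ b 3 ≡ b 2
  a₂≤a₁⇒b₃∈ a₂≤a₁ with c ℤP.≟ 0ℤ
  ... | yes c≡0 = inj₁ (c≡0⇒b₃≡b₁ c≡0)
  ... | no c≢0  = go (e + 1ℤ) refl ∣e+1∣≤1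
    where
    e = c ^ suc k
    open +-*-Solver
    b₂≡ : b 2 ≡ c * (e + 1ℤ)
    b₂≡ = trans (cong φ b₁≡c)
      (solve 2 (λ c e → c :* e :+ c := c :* (e :+ con 1ℤ)) refl c e)
    ∣e+1∣≤1 : ∣ e + 1ℤ ∣ ≤ 1
    ∣e+1∣≤1 = ℕP.*-cancelˡ-≤ ∣ c ∣ {{ℕ.≢-nonZero (c≢0 ∘ ℤP.∣i∣≡0⇒i≡0)}} (begin
      ∣ c ∣ ℕ.* ∣ e + 1ℤ ∣  ≡⟨ ℤP.abs-* c (e + 1ℤ) ⟨
      ∣ c * (e + 1ℤ) ∣      ≡⟨ cong ∣_∣ b₂≡ ⟨
      a 2                   ≤⟨ a₂≤a₁ ⟩
      a 1                   ≡⟨ cong ∣_∣ b₁≡c ⟩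
      ∣ c ∣                 ≡⟨ ℕP.*-identityʳ ∣ c ∣ ⟨
      ∣ c ∣ ℕ.* 1           ∎)
      where open ℕP.≤-Reasoning
    e≡ : ∀ {v} → e + 1ℤ ≡ v → e ≡ v - 1ℤ
    e≡ refl = solve 1 (λ e → e := e :+ con 1ℤ :- con 1ℤ) refl e
    c≡-2 : k ≡ 0 × c ≡ -[1+ 1 ] → b 3 ≡ b 2
    c≡-2 (refl , refl) = refl
    go : ∀ v → e + 1ℤ ≡ v → ∣ v ∣ ≤ 1 → b 3 ≡ b 1 ⊎ b 3 ≡ b 2
    -- Here `b 2 = 0`, so the orbit starts over.
    go (+ 0) eq _ = inj₁ (cong φ (trans b₂≡ (trans (cong (c *_) eq) (ℤP.*-zeroʳ c))))
    go (+ 1) eq _ = contradiction (ℤP.i^n≡0⇒i≡0 c (suc k) (e≡ eq)) c≢0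
    go (+ suc (suc _)) _ (s≤s ())
    -- Now `e = -2`, so the map is `z² - 2` and the orbit is -2, 2, 2, and so on.
    go -[1+ 0 ] eq _ = inj₂ (c≡-2 (i*i^n≡-2⇒ c k (e≡ eq)))
    go -[1+ suc _ ] _ (s≤s ())

  -- Primitive primes when zero wanders

  module _ (wandering : Wandering φ 0ℤ) where

    a₁<a₂ : a 1 < a 2
    a₁<a₂ = ℕP.≰⇒> λ a₂≤a₁ → b₃∈⇒¬wandering (a₂≤a₁⇒b₃∈ a₂≤a₁) wandering

    c≢0 : ¬ c ≡ 0ℤ
    c≢0 c≡0 = b₃∈⇒¬wandering (inj₁ (c≡0⇒b₃≡b₁ c≡0)) wandering

    a₁>0 : 0 < a 1
    a₁>0 = ℕP.n≢0⇒n>0 λ a₁≡0 → c≢0 (trans (sym b₁≡c) (ℤP.∣i∣≡0⇒i≡0 a₁≡0))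

    ∏<a : ∀ n → ∏≤ a (suc n) < a (suc (suc n))
    ∏<a n = proj₂ (growth a a₁>0 a₁<a₂ square-growth n)

    rigid : RigidDivisibility a
    rigid = record { positive = positive ; remainder = ∣-remainder ; multiple = multiple }
      where
      positive : ∀ n → 0 < a (suc n)
      positive zero    = a₁>0
      positive (suc n) = ℕP.<-trans a₁>0 (proj₁ (growth a a₁>0 a₁<a₂ square-growth n))

    a₁>1 : ¬ (c ≡ 1ℤ ⊎ c ≡ -1ℤ) → 1 < a 1
    a₁>1 c≢±1 = subst (λ w → 1 < ∣ w ∣) (sym b₁≡c) (go c refl)
      where
      go : ∀ i → c ≡ i → 1 < ∣ i ∣
      go (+ 0)            eq = contradiction eq c≢0
      go (+ 1)            eq = contradiction (inj₁ eq) c≢±1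
      go (+ suc (suc _))  _  = s≤s (s≤s z≤n)
      go -[1+ 0 ]         eq = contradiction (inj₂ eq) c≢±1
      go -[1+ suc _ ]     _  = s≤s (s≤s z≤n)

theorem3 : (c : ℤ) (d : ℕ) → 2 ≤ d →
    let φ = unicritical d c
        b = λ n → (φ ⟨ n ⟩) 0ℤ
    in Wandering φ 0ℤ →
       ((c ≡ 1ℤ ⊎ c ≡ -1ℤ) → ∀ n → 2 ≤ n → HasPrimitivePrimeDivisor b n) ×
       (¬ (c ≡ 1ℤ ⊎ c ≡ -1ℤ) → ∀ n → 1 ≤ n → HasPrimitivePrimeDivisor b n)
theorem3 c (suc (suc k)) (s≤s (s≤s z≤n)) wandering =
  (λ _ → from-2) , λ where
    -- No term precedes `b 1`, so the product to exceed is the empty one; `1 < a 1` is where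
    -- `c ≠ ±1` enters.
    c≢±1 1             _ → ∃-primitive-prime (rigid wandering) 0 (a₁>1 wandering c≢±1)
    c≢±1 (suc (suc n)) _ → from-2 (suc (suc n)) (s≤s (s≤s z≤n))
  where
  open ZeroOrbit k c
  from-2 : ∀ n → 2 ≤ n → HasPrimitivePrimeDivisor b n
  from-2 (suc (suc n)) _ = ∃-primitive-prime (rigid wandering) (suc n) (∏<a wandering n)
  from-2 1 (s≤s ())
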